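{- Let $m\in\mathbb{Z}\setminus\{0,-1\}$ and define integers $c_m(n)$ by $$\frac{1}{(1-x)^{m}}\prod_{i=0}^{\infty}\frac{1}{(1-x^{2^{i}})^{m}}=\sum_{n=0}^{\infty}c_{m}(n)x^{n}.$$ Then the sequence $(\nu_2(c_m(n)))_{n\ge 1}$ is $2$-automatic.
   Context: $\nu_2(a)$ is the $2$-adic valuation of the integer $a$. A sequence $(e_n)_{n\ge 0}$ is $k$-automatic ($k\ge2$) if its $k$-kernel $\{(e_{k^in+j})_{n\ge 0}: i\ge 0,\ 0\le j<k^i\}$ is finite; a sequence indexed by $n\ge1$ is $k$-automatic if its shift $(e_{n+1})_{n\ge0}$ is. -}

module Defs where

open import Data.Nat as ℕ using (ℕ; zero; suc; _^_; _<_; _≡ᵇ_)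
open import Data.Nat.Divisibility using (_∣?_)
open import Data.Nat.DivMod using (_/_; _%_)
open import Data.Integer as ℤ using (ℤ; +_; -[1+_])
open import Data.Bool using (if_then_else_)
open import Data.Maybe using (Maybe; just; nothing)
open import Data.List using (List)
open import Data.Product using (Σ)
open import Data.List.Relation.Unary.Any using (Any)
open import Relation.Binary.PropositionalEquality using (_≡_)
open import Relation.Nullary.Decidable using (does)

Series : Set
Series = ℕ → ℤ

sumTo : ℕ → (ℕ → ℤ) → ℤ
sumTo zero    f = f 0
sumTo (suc n) f = sumTo n f ℤ.+ f (suc n)

_⊛_ : Series → Series → Series
(f ⊛ g) n = sumTo n (λ k → f k ℤ.* g (n ℕ.∸ k))

oneS : Series
oneS zero    = + 1
oneS (suc _) = + 0

-- 1/(1 - x^k)  (used for k ≥ 1)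
geom : ℕ → Series
geom k n = if does (k ∣? n) then + 1 else + 0

-- 1 - x^k  (used for k ≥ 1)
lin : ℕ → Series
lin k zero    = + 1
lin k (suc n) = if suc n ≡ᵇ k then -[1+ 0 ] else + 0

powS : Series → ℕ → Series
powS f zero    = oneS
powS f (suc p) = f ⊛ powS f p

factor : ℤ → ℕ → Series
factor (+ p)     k = powS (geom k) p
factor -[1+ q ]  k = powS (lin k) (suc q)

prodTo : ℤ → ℕ → Series
prodTo m zero    = factor m 1
prodTo m (suc N) = prodTo m N ⊛ factor m (2 ^ suc N)

-- c_m(n): coefficient of x^n in (1-x)^(-m) ∏_{i≥0} (1-x^(2^i))^(-m).
-- Factors with 2^i > n do not affect the coefficient of x^n, and 2^n > n,
-- so truncating the infinite product at i = n is exact.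
c : ℤ → ℕ → ℤ
c m n = (factor m 1 ⊛ prodTo m n) n

-- 2-adic valuation; nothing encodes ν₂(0) = ∞.
ν2ℕ-go : ℕ → ℕ → ℕ
ν2ℕ-go zero       n = 0
ν2ℕ-go (suc fuel) n = if (n % 2) ≡ᵇ 0 then suc (ν2ℕ-go fuel (n / 2)) else 0

ν₂ : ℤ → Maybe ℕ
ν₂ a with ℤ.∣ a ∣
... | zero  = nothing
... | suc k = just (ν2ℕ-go (suc k) (suc k))

-- k-automatic: the k-kernel {n ↦ e (k^i n + j) : i ≥ 0, 0 ≤ j < k^i}
-- is finite, i.e. covered (up to pointwise equality) by a finite list.
Automatic : {A : Set} → ℕ → (ℕ → A) → Set
Automatic {A} k e =
  Σ (List (ℕ → A)) λ L →
    ∀ i j → j < k ^ i → Any (λ f → ∀ n → f n ≡ e (k ^ i ℕ.* n ℕ.+ j)) L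

{-# OPTIONS --safe #-}
module Submission where

-- Let D = (1 - x) ∏ (1 - x^(2^i)), so that Σ c_m(n) xⁿ = D^(-m), and u = x/(1 - x).  Telescoping the product shows
-- D² ≡ 1 + 4u (mod 8), and the same holds for D⁻².  Squaring repeatedly, D^(±2j) ≡ 1 + 2^(s+2) u (mod 2^(s+3))
-- with s = ν₂(j).  So for even m ≠ 0 all valuations at n ≥ 1 equal s + 2, where m = ±2j.  For odd m ≠ -1 write
-- D^(-m) = D · D^(±2j) with 2j = |m + 1|: since D u = x ∏ (1 - x^(2^i)) has the Thue–Morse signs t as coefficients,
-- c_m(n + 1) ≡ t(n + 1) - t(n) + 2^(s+2) t(n) (mod 2^(s+3)), whose valuation is 1 or s + 2 according to whether
-- t changes sign at n.  The indicator p of sign changes satisfies p(2n) = 1 and p(2n + 1) = 1 - p(n), which makes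
-- its 2-kernel finite.

open import Defs
open import Data.Nat using (ℕ; suc)
open import Data.Integer using (ℤ; +_; -[1+_])
open import Relation.Binary.PropositionalEquality using (_≢_)

open import Algebra.Bundles using (CommutativeRing)
open import Algebra.Solver.Ring.AlmostCommutativeRing using (fromCommutativeRing; _-Raw-AlmostCommutative⟶_)
open import Data.Bool using (Bool; true; false; not; _xor_; if_then_else_)
open import Data.Integer as ℤ using (_+_; _*_; _-_; -_; 0ℤ; 1ℤ)
import Data.Integer.Properties as ℤₚ
open import Data.Integer.Divisibility.Signed using (∣ᵤ⇒∣; ∣⇒∣ᵤ; ∣m⇒∣m*n; ∣m+n∣n⇒∣m) renaming (∣-refl to ∣ₛ-refl)
open import Data.Integer.Tactic.RingSolver using (solve-∀)
open import Data.Nat.Tactic.RingSolver using () renaming (solve-∀ to ℕ-solve-∀)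
open import Data.Maybe as Maybe using (just)
open import Data.Nat as ℕ using (zero; _^_; _<_; _≤_; s≤s; z≤n; _≡ᵇ_)
import Data.Nat.Properties as ℕₚ
open import Data.Nat.DivMod using (_/_; _%_; [m+kn]%n≡m%n; m*n%n≡0; m*n/n≡m)
open import Data.Nat.Induction using (<-rec)
open import Data.Nat.Divisibility using (_∣_; divides; _∣?_; ∣m∣n⇒∣m+n; ∣m+n∣m⇒∣n; ∣-refl; 1∣_; _∣0; ∣⇒≤)
open import Data.List using (_∷_; [])
open import Data.List.Relation.Unary.Any using (here; there)
open import Data.Product using (_×_; _,_; proj₁; proj₂; ∃)
open import Data.Sum using (_⊎_; inj₁; inj₂)
open import Function.Bundles using (mk⇔)
open import Level using (0ℓ)
open import Relation.Binary.PropositionalEquality using (_≡_; refl; sym; trans; cong; cong₂; subst; module ≡-Reasoning)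
open import Relation.Nullary using (¬_; yes; no; contradiction)
open import Relation.Nullary.Decidable using (does; dec⇒maybe; dec-true; dec-false; does-⇔; from-no)

private
  variable
    f f′ g g′ : Series

-- Formal power series

_⊕_ : Series → Series → Series
(f ⊕ g) n = f n + g n

neg : Series → Series
neg f n = - f n

const : ℤ → Series
const a zero    = a
const a (suc n) = 0ℤ

tail : Series → Series
tail f n = f (suc n)

shift : ℕ → Series → Series
shift zero    f n       = f n
shift (suc k) f zero    = 0ℤ
shift (suc k) f (suc n) = shift k f n

sumTo-cong : ∀ n {a b : ℕ → ℤ} → (∀ k → k ≤ n → a k ≡ b k) → sumTo n a ≡ sumTo n b
sumTo-cong zero    a≡b = a≡b 0 z≤n
sumTo-cong (suc n) a≡b =
  cong₂ _+_ (sumTo-cong n λ k k≤n → a≡b k (ℕₚ.m≤n⇒m≤1+n k≤n)) (a≡b (suc n) ℕₚ.≤-refl)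

sumTo-head : ∀ n (a : ℕ → ℤ) → sumTo (suc n) a ≡ a 0 + sumTo n (λ k → a (suc k))
sumTo-head zero    a = refl
sumTo-head (suc n) a =
  trans (cong (_+ a (suc (suc n))) (sumTo-head n a))
        (ℤₚ.+-assoc (a 0) (sumTo n (λ k → a (suc k))) (a (suc (suc n))))

⊛-head : ∀ f g n → (f ⊛ g) (suc n) ≡ f 0 * g (suc n) + (tail f ⊛ g) n
⊛-head f g n = sumTo-head n (λ k → f k * g (suc n ℕ.∸ k))

⊛-last : ∀ f g n → (f ⊛ g) (suc n) ≡ (f ⊛ tail g) n + f (suc n) * g 0
⊛-last f g n = cong₂ _+_
  (sumTo-cong n λ k k≤n → cong (λ i → f k * g i) (ℕₚ.+-∸-assoc 1 k≤n))
  (cong (λ i → f (suc n) * g i) (ℕₚ.n∸n≡0 n))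

-- A product coefficient in degree n only involves degrees up to n, which is why multiplication
-- respects equality modulo a power of x.
⊛-cong-≤ : ∀ n → (∀ k → k ≤ n → f k ≡ f′ k) → (∀ k → k ≤ n → g k ≡ g′ k) →
           (f ⊛ g) n ≡ (f′ ⊛ g′) n
⊛-cong-≤ n p q = sumTo-cong n λ k k≤n → cong₂ _*_ (p k k≤n) (q (n ℕ.∸ k) (ℕₚ.m∸n≤m n k))

-- Induction on the degree: the first summand of one product is split off and matched with the last
-- summand of the other.
⊛-comm : ∀ f g n → (f ⊛ g) n ≡ (g ⊛ f) n
⊛-comm f g zero    = ℤₚ.*-comm (f 0) (g 0)
⊛-comm f g (suc n) = begin
  (f ⊛ g) (suc n)                        ≡⟨ ⊛-head f g n ⟩
  f 0 * g (suc n) + (tail f ⊛ g) n     ≡⟨ ℤₚ.+-comm (f 0 * g (suc n)) _ ⟩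
  (tail f ⊛ g) n + f 0 * g (suc n)     ≡⟨ cong₂ _+_ (⊛-comm (tail f) g n) (ℤₚ.*-comm (f 0) (g (suc n))) ⟩
  (g ⊛ tail f) n + g (suc n) * f 0     ≡⟨ ⊛-last g f n ⟨
  (g ⊛ f) (suc n)                        ∎
  where open ≡-Reasoning

⊛-distribʳ : ∀ h f g n → ((f ⊕ g) ⊛ h) n ≡ (f ⊛ h) n + (g ⊛ h) n
⊛-distribʳ h f g zero    = ℤₚ.*-distribʳ-+ (h 0) (f 0) (g 0)
⊛-distribʳ h f g (suc n) = begin
  ((f ⊕ g) ⊛ h) (suc n)
    ≡⟨ ⊛-head (f ⊕ g) h n ⟩
  (f 0 + g 0) * h (suc n) + ((tail f ⊕ tail g) ⊛ h) n
    ≡⟨ cong (λ z → (f 0 + g 0) * h (suc n) + z) (⊛-distribʳ h (tail f) (tail g) n) ⟩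
  (f 0 + g 0) * h (suc n) + ((tail f ⊛ h) n + (tail g ⊛ h) n)
    ≡⟨ regroup (f 0) (g 0) (h (suc n)) _ _ ⟩
  (f 0 * h (suc n) + (tail f ⊛ h) n) + (g 0 * h (suc n) + (tail g ⊛ h) n)
    ≡⟨ cong₂ _+_ (⊛-head f h n) (⊛-head g h n) ⟨
  (f ⊛ h) (suc n) + (g ⊛ h) (suc n) ∎
  where
  open ≡-Reasoning
  regroup : ∀ a b c x y → (a + b) * c + (x + y) ≡ (a * c + x) + (b * c + y)
  regroup = solve-∀

⊛-distribˡ : ∀ h f g n → (h ⊛ (f ⊕ g)) n ≡ (h ⊛ f) n + (h ⊛ g) n
⊛-distribˡ h f g n = trans (⊛-comm h (f ⊕ g) n)
  (trans (⊛-distribʳ h f g n) (cong₂ _+_ (⊛-comm f h n) (⊛-comm g h n)))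

zero-⊛ : ∀ (a : ℕ → ℤ) f n → (∀ k → a k ≡ 0ℤ) → (a ⊛ f) n ≡ 0ℤ
zero-⊛ a f zero    a≡0 = trans (cong (_* f 0) (a≡0 0)) (ℤₚ.*-zeroˡ (f 0))
zero-⊛ a f (suc n) a≡0 = trans (⊛-head a f n)
  (cong₂ _+_ (trans (cong (_* f (suc n)) (a≡0 0)) (ℤₚ.*-zeroˡ (f (suc n))))
               (zero-⊛ (tail a) f n (λ k → a≡0 (suc k))))

const-⊛ : ∀ a f n → (const a ⊛ f) n ≡ a * f n
const-⊛ a f zero    = refl
const-⊛ a f (suc n) = trans (⊛-head (const a) f n)
  (trans (cong (λ z → a * f (suc n) + z) (zero-⊛ (tail (const a)) f n λ _ → refl)) (ℤₚ.+-identityʳ _))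

scale-⊛ : ∀ a g h n → ((λ k → a * g k) ⊛ h) n ≡ a * (g ⊛ h) n
scale-⊛ a g h zero    = ℤₚ.*-assoc a (g 0) (h 0)
scale-⊛ a g h (suc n) = begin
  ((λ k → a * g k) ⊛ h) (suc n)
    ≡⟨ ⊛-head (λ k → a * g k) h n ⟩
  a * g 0 * h (suc n) + ((λ k → a * g (suc k)) ⊛ h) n
    ≡⟨ cong₂ _+_ (ℤₚ.*-assoc a (g 0) (h (suc n))) (scale-⊛ a (tail g) h n) ⟩
  a * (g 0 * h (suc n)) + a * (tail g ⊛ h) n
    ≡⟨ ℤₚ.*-distribˡ-+ a _ _ ⟨
  a * (g 0 * h (suc n) + (tail g ⊛ h) n)
    ≡⟨ cong (a *_) (⊛-head g h n) ⟨
  a * (g ⊛ h) (suc n) ∎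
  where open ≡-Reasoning

⊛-assoc : ∀ f g h n → ((f ⊛ g) ⊛ h) n ≡ (f ⊛ (g ⊛ h)) n
⊛-assoc f g h zero    = ℤₚ.*-assoc (f 0) (g 0) (h 0)
⊛-assoc f g h (suc n) = begin
  ((f ⊛ g) ⊛ h) (suc n)
    ≡⟨ ⊛-head (f ⊛ g) h n ⟩
  f 0 * g 0 * h (suc n) + (tail (f ⊛ g) ⊛ h) n
    ≡⟨ cong (λ z → f 0 * g 0 * h (suc n) + z) (⊛-cong-≤ {f′ = (λ k → f 0 * g (suc k)) ⊕ (tail f ⊛ g)} {g = h} n (λ k _ → ⊛-head f g k) (λ _ _ → refl)) ⟩
  f 0 * g 0 * h (suc n) + (((λ k → f 0 * g (suc k)) ⊕ (tail f ⊛ g)) ⊛ h) n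
    ≡⟨ cong (λ z → f 0 * g 0 * h (suc n) + z) (⊛-distribʳ h (λ k → f 0 * g (suc k)) (tail f ⊛ g) n) ⟩
  f 0 * g 0 * h (suc n) + (((λ k → f 0 * g (suc k)) ⊛ h) n + ((tail f ⊛ g) ⊛ h) n)
    ≡⟨ cong (λ z → f 0 * g 0 * h (suc n) + z) (cong₂ _+_ (scale-⊛ (f 0) (tail g) h n) (⊛-assoc (tail f) g h n)) ⟩
  f 0 * g 0 * h (suc n) + (f 0 * (tail g ⊛ h) n + (tail f ⊛ (g ⊛ h)) n)
    ≡⟨ regroup (f 0) (g 0) (h (suc n)) _ _ ⟩
  f 0 * (g 0 * h (suc n) + (tail g ⊛ h) n) + (tail f ⊛ (g ⊛ h)) n
    ≡⟨ cong (λ z → f 0 * z + (tail f ⊛ (g ⊛ h)) n) (⊛-head g h n) ⟨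
  f 0 * (g ⊛ h) (suc n) + (tail f ⊛ (g ⊛ h)) n
    ≡⟨ ⊛-head f (g ⊛ h) n ⟨
  (f ⊛ (g ⊛ h)) (suc n) ∎
  where
  open ≡-Reasoning
  regroup : ∀ a b c x y → a * b * c + (a * x + y) ≡ a * (b * c + x) + y
  regroup = solve-∀

const-1 : ∀ n → const 1ℤ n ≡ oneS n
const-1 zero    = refl
const-1 (suc n) = refl

oneS-⊛ : ∀ f n → (oneS ⊛ f) n ≡ f n
oneS-⊛ f n = trans (⊛-cong-≤ {f = oneS} {f′ = const 1ℤ} {g = f} n (λ k _ → sym (const-1 k)) (λ _ _ → refl))
  (trans (const-⊛ 1ℤ f n) (ℤₚ.*-identityˡ (f n)))

-- Equality modulo x^K instead of exact equality: for 2^N ≥ K the monomial x^(2^N) becomes zero, so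
-- finite products already satisfy the congruences of the infinite one. The record keeps both series
-- visible to unification.
record _≈[_]_ (f : Series) (K : ℕ) (g : Series) : Set where
  constructor below
  field
    coeff : ∀ n → n < K → f n ≡ g n
open _≈[_]_

everywhere : ∀ {K} → (∀ n → f n ≡ g n) → f ≈[ K ] g
everywhere f≡g = below λ n _ → f≡g n

-- The ring ℤ[[x]]/(x^K).
truncated : ℕ → CommutativeRing 0ℓ 0ℓ
truncated K = record
  { Carrier = Series
  ; _≈_ = _≈[ K ]_
  ; _+_ = _⊕_
  ; _*_ = _⊛_
  ; -_ = neg
  ; 0# = const 0ℤ
  ; 1# = oneS
  ; isCommutativeRing = record
    { isRing = record
      { +-isAbelianGroup = record
        { isGroup = record
          { isMonoid = record
            { isSemigroup = record
              { isMagma = record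
                { isEquivalence = record
                  { refl = everywhere λ _ → refl
                  ; sym = λ p → below λ n n<K → sym (coeff p n n<K)
                  ; trans = λ p q → below λ n n<K → trans (coeff p n n<K) (coeff q n n<K)
                  }
                ; ∙-cong = λ p q → below λ n n<K → cong₂ _+_ (coeff p n n<K) (coeff q n n<K)
                }
              ; assoc = λ f g h → everywhere λ n → ℤₚ.+-assoc (f n) (g n) (h n)
              }
            ; identity = (λ f → everywhere λ n → trans (cong (_+ f n) (const-0 n)) (ℤₚ.+-identityˡ (f n)))
                       , (λ f → everywhere λ n → trans (cong (λ z → f n + z) (const-0 n)) (ℤₚ.+-identityʳ (f n)))
            }
          ; inverse = (λ f → everywhere λ n → trans (ℤₚ.+-inverseˡ (f n)) (sym (const-0 n)))
                    , (λ f → everywhere λ n → trans (ℤₚ.+-inverseʳ (f n)) (sym (const-0 n)))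
          ; ⁻¹-cong = λ p → below λ n n<K → cong -_ (coeff p n n<K)
          }
        ; comm = λ f g → everywhere λ n → ℤₚ.+-comm (f n) (g n)
        }
      ; *-cong = λ p q → below λ n n<K → ⊛-cong-≤ n
          (λ k k≤n → coeff p k (ℕₚ.≤-<-trans k≤n n<K)) (λ k k≤n → coeff q k (ℕₚ.≤-<-trans k≤n n<K))
      ; *-assoc = λ f g h → everywhere (⊛-assoc f g h)
      ; *-identity = (λ f → everywhere (oneS-⊛ f)) , (λ f → everywhere λ n → trans (⊛-comm f oneS n) (oneS-⊛ f n))
      ; distrib = (λ f g h → everywhere (⊛-distribˡ f g h)) , (λ f g h → everywhere (⊛-distribʳ f g h))
      }
    ; *-comm = λ f g → everywhere (⊛-comm f g)
    }
  }
  where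
  const-0 : ∀ n → const 0ℤ n ≡ 0ℤ
  const-0 zero    = refl
  const-0 (suc n) = refl

-- Lets the ring solver compute with integer coefficients, whose equality is decidable, while its
-- variables range over series.
constants : ∀ K → CommutativeRing.rawRing ℤₚ.+-*-commutativeRing -Raw-AlmostCommutative⟶ fromCommutativeRing (truncated K)
constants K = record
  { ⟦_⟧ = const
  ; +-homo = λ a b → everywhere λ { zero → refl ; (suc n) → refl }
  ; *-homo = λ a b → everywhere λ { zero → refl ; (suc n) → sym (trans (const-⊛ a (const b) (suc n)) (ℤₚ.*-zeroʳ a)) }
  ; -‿homo = λ a → everywhere λ { zero → refl ; (suc n) → refl }
  ; 0-homo = everywhere λ _ → refl
  ; 1-homo = everywhere const-1
  }

-- Congruences modulo powers of 2 in a commutative ring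

module Congruences (R : CommutativeRing 0ℓ 0ℓ)
  (integers : CommutativeRing.rawRing ℤₚ.+-*-commutativeRing -Raw-AlmostCommutative⟶ fromCommutativeRing R) where

  open CommutativeRing R renaming (_+_ to _⊞_; _*_ to _⊠_; -_ to ⊟_; refl to ≈-refl; sym to ≈-sym; trans to ≈-trans)
  open _-Raw-AlmostCommutative⟶_ integers renaming (⟦_⟧ to ι)
  open import Algebra.Properties.CommutativeSemiring.Exp commutativeSemiring renaming (_^_ to _**_)
  open import Algebra.Properties.CommutativeSemigroup *-commutativeSemigroup using (interchange)
  open import Relation.Binary.Reasoning.Setoid setoid
  open import Algebra.Solver.Ring (CommutativeRing.rawRing ℤₚ.+-*-commutativeRing) (fromCommutativeRing R) integers
    (λ a b → Maybe.map (λ a≡b → reflexive (cong ι a≡b)) (dec⇒maybe (a ℤ.≟ b)))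

  one : Carrier
  one = ι 1ℤ

  -- The general element congruent to 1 + 4bu modulo 8b.
  near : (b u z : Carrier) → Carrier
  near b u z = one ⊞ ι (+ 4) ⊠ (b ⊠ u) ⊞ ι (+ 8) ⊠ (b ⊠ z)

  near-cong : ∀ {b b′} u z → b ≈ b′ → near b u z ≈ near b′ u z
  near-cong u z b≈b′ = +-cong (+-congˡ (*-congˡ (*-congʳ b≈b′))) (*-congˡ (*-congʳ b≈b′))

  :near : ∀ {n} (b u z : Polynomial n) → Polynomial n
  :near b u z = con 1ℤ :+ con (+ 4) :* (b :* u) :+ con (+ 8) :* (b :* z)

  -- With t = u + 2z the element is 1 + 4bt, and its square 1 + 8bt + 16b²t² has the same shape with
  -- 2b for b and z + bt² for z.
  square-near : ∀ b u z → near b u z ⊠ near b u z ≈ near (ι (+ 2) ⊠ b) u (z ⊞ b ⊠ ((u ⊞ ι (+ 2) ⊠ z) ⊠ (u ⊞ ι (+ 2) ⊠ z)))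
  square-near = solve 3 (λ b u z → :near b u z :* :near b u z
    := :near (con (+ 2) :* b) u (z :+ b :* ((u :+ con (+ 2) :* z) :* (u :+ con (+ 2) :* z)))) ≈-refl

  -- The square of 1 + 4bt, with t = u + 2z, is 1 + 8b(t + 2bt²). Being 1 modulo 8b, it only alters
  -- the last term of the other factor.
  odd-power-step : ∀ b u z w → near b u z ⊠ (near b u z ⊠ near b u w) ≈
    near b u (w ⊞ ((u ⊞ ι (+ 2) ⊠ z) ⊞ ι (+ 2) ⊠ (b ⊠ ((u ⊞ ι (+ 2) ⊠ z) ⊠ (u ⊞ ι (+ 2) ⊠ z)))) ⊠ near b u w)
  odd-power-step = solve 4 (λ b u z w → :near b u z :* (:near b u z :* :near b u w) :=
    :near b u (w :+ ((u :+ con (+ 2) :* z) :+ con (+ 2) :* (b :* ((u :+ con (+ 2) :* z) :* (u :+ con (+ 2) :* z)))) :* :near b u w)) ≈-refl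

  odd-power : ∀ {x} b u z → x ≈ near b u z → ∀ o → ∃ λ w → x ** suc (o ℕ.* 2) ≈ near b u w
  odd-power {x} b u z x≈ zero = z , ≈-trans (*-identityʳ x) x≈
  odd-power {x} b u z x≈ (suc o) with odd-power b u z x≈ o
  ... | w , p = _ , ≈-trans (*-cong x≈ (*-cong x≈ p)) (odd-power-step b u z w)

  two-power : ∀ {x} u z → x ≈ near one u z → ∀ s → ∃ λ w → x ** (2 ^ s) ≈ near (ι (+ (2 ^ s))) u w
  two-power {x} u z x≈ zero = z , ≈-trans (*-identityʳ x) x≈
  two-power {x} u z x≈ (suc s) with two-power u z x≈ s
  ... | w , p = w′ , (begin
    x ** (2 ^ suc s)                                       ≈⟨ ^-homo-* x (2 ^ s) (2 ^ s ℕ.+ 0) ⟩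
    -- `2 ^ suc s` computes to `2 ^ s ℕ.+ (2 ^ s ℕ.+ 0)`, whence the trailing zero.
    x ** (2 ^ s) ⊠ x ** (2 ^ s ℕ.+ 0)                      ≡⟨ cong (λ k → x ** (2 ^ s) ⊠ x ** k) (ℕₚ.+-identityʳ (2 ^ s)) ⟩
    x ** (2 ^ s) ⊠ x ** (2 ^ s)                            ≈⟨ *-cong p p ⟩
    near (ι (+ (2 ^ s))) u w ⊠ near (ι (+ (2 ^ s))) u w    ≈⟨ square-near _ u w ⟩
    near (ι (+ 2) ⊠ ι (+ (2 ^ s))) u w′                    ≈⟨ near-cong u w′ (*-homo (+ 2) (+ (2 ^ s))) ⟨
    near (ι (+ 2 * + (2 ^ s))) u w′                        ≡⟨ cong (λ a → near (ι a) u w′) (ℤₚ.pos-* 2 (2 ^ s)) ⟨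
    near (ι (+ (2 ^ suc s))) u w′                          ∎)
    where
    w′ = w ⊞ ι (+ (2 ^ s)) ⊠ ((u ⊞ ι (+ 2) ⊠ w) ⊠ (u ⊞ ι (+ 2) ⊠ w))

  power : ∀ {x} u z → x ≈ near one u z → ∀ s o → ∃ λ w → x ** (2 ^ s ℕ.* suc (o ℕ.* 2)) ≈ near (ι (+ (2 ^ s))) u w
  power {x} u z x≈ s o with two-power u z x≈ s
  ... | w , p with odd-power _ u w p o
  ... | w′ , q = w′ , ≈-trans (≈-sym (^-assocʳ x (2 ^ s) (suc (o ℕ.* 2)))) q

  -- Modulo 8 the element 1 + 4u is its own inverse: (1 + 4u)(1 + 4u + 8z) = 1 + 8(u + 2u² + z +
  -- 4uz). Multiplying by `y` and cancelling `y ⊠ x` leaves y = 1 + 4u + 8w.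
  inverse-near : ∀ {x y} u z → x ≈ near one u z → y ⊠ x ≈ one → ∃ λ w → y ≈ near one u w
  inverse-near {x} {y} u z x≈ yx≈1 = _ , (begin
    y ≈⟨ solve 3 (λ y u z → y :=
           (con 1ℤ :+ con (+ 4) :* u) :* (y :* :near (con 1ℤ) u z) :+ con (+ 8) :* (:- (y :* (u :+ con (+ 2) :* (u :* u) :+ z :+ con (+ 4) :* (u :* z)))))
           ≈-refl y u z ⟩
    (one ⊞ ι (+ 4) ⊠ u) ⊠ (y ⊠ near one u z) ⊞ ι (+ 8) ⊠ w  ≈⟨ +-congʳ (*-congˡ (≈-trans (*-congˡ (≈-sym x≈)) yx≈1)) ⟩
    (one ⊞ ι (+ 4) ⊠ u) ⊠ one ⊞ ι (+ 8) ⊠ w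
      ≈⟨ solve 2 (λ u w → (con 1ℤ :+ con (+ 4) :* u) :* con 1ℤ :+ con (+ 8) :* w := :near (con 1ℤ) u w) ≈-refl u w ⟩
    near one u w ∎)
    where
    w = ⊟ (y ⊠ (u ⊞ ι (+ 2) ⊠ (u ⊠ u) ⊞ z ⊞ ι (+ 4) ⊠ (u ⊠ z)))

  -- Isolates `u ⊠ d`, because for the product series `d` this is x times the Thue-Morse series.
  multiply-near : ∀ d b u z → d ⊠ near b u z ≈ d ⊞ ι (+ 4) ⊠ (b ⊠ (u ⊠ d)) ⊞ ι (+ 8) ⊠ (b ⊠ (d ⊠ z))
  multiply-near = solve 4 (λ d b u z → d :* :near b u z :=
    d :+ con (+ 4) :* (b :* (u :* d)) :+ con (+ 8) :* (b :* (d :* z))) ≈-refl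

  -- The shape of the square of (1 - x) ∏_{i ≤ N} (1 - x^(2^i)) modulo 8, where y = x^(2^N), u = x/(1 - x), v = y/(1 - y).
  telescoped : (y u v : Carrier) → Carrier
  telescoped y u v = (one ⊞ ι (+ 4) ⊠ (u ⊞ ⊟ v)) ⊠ (((one ⊞ ⊟ y) ⊠ (one ⊞ ⊟ y)) ⊠ ((one ⊞ ⊟ y) ⊠ (one ⊞ ⊟ y)))

  :telescoped : ∀ {n} (y u v : Polynomial n) → Polynomial n
  :telescoped y u v = (con 1ℤ :+ con (+ 4) :* (u :+ :- v)) :* (((con 1ℤ :+ :- y) :* (con 1ℤ :+ :- y)) :* ((con 1ℤ :+ :- y) :* (con 1ℤ :+ :- y)))

  -- Let p = 1 - y and q = 1 - y². As pv = y and qw = y², the elements p⁴(1 + 4(u - v)) = ((1 + 4u)p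
  -- - 4y)p³ and q²(1 + 4(u - w)) = ((1 + 4u)q - 4y²)q are polynomials in y and u. Their difference
  -- is 8p(-y + 2y² - 2uyp), and multiplying by q² gives the step from y to y².
  telescope : ∀ {d} y u v w z → d ⊠ d ≈ telescoped y u v ⊞ ι (+ 8) ⊠ z →
    (one ⊞ ⊟ y) ⊠ v ≈ y → (one ⊞ ⊟ (y ⊠ y)) ⊠ w ≈ y ⊠ y →
    ∃ λ z′ → (d ⊠ (one ⊞ ⊟ (y ⊠ y))) ⊠ (d ⊠ (one ⊞ ⊟ (y ⊠ y))) ≈ telescoped (y ⊠ y) u w ⊞ ι (+ 8) ⊠ z′
  telescope {d} y u v w z d²≈ v≈ w≈ = z′ , (begin
    (d ⊠ q) ⊠ (d ⊠ q)
      ≈⟨ solve 2 (λ d q → (d :* q) :* (d :* q) := (d :* d) :* (q :* q)) ≈-refl d q ⟩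
    (d ⊠ d) ⊠ (q ⊠ q)
      ≈⟨ *-congʳ d²≈ ⟩
    (telescoped y u v ⊞ ι (+ 8) ⊠ z) ⊠ (q ⊠ q)
      ≈⟨ solve 4 (λ y u v z → (:telescoped y u v :+ con (+ 8) :* z) :* (:q y :* :q y) := :left y u z ((con 1ℤ :+ :- y) :* v)) ≈-refl y u v z ⟩
    left ((one ⊞ ⊟ y) ⊠ v)
      ≈⟨ +-congʳ (*-congʳ (*-congʳ (+-congˡ (-‿cong (*-congˡ v≈))))) ⟩
    left y
      ≈⟨ solve 3 (λ y u z → :left y u z y := :right y u z (y :* y)) ≈-refl y u z ⟩
    right (y ⊠ y)
      ≈⟨ +-congʳ (*-congʳ (+-congˡ (-‿cong (*-congˡ w≈)))) ⟨
    right (q ⊠ w)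
      ≈⟨ solve 4 (λ y u w z → :right y u z (:q y :* w) := :telescoped (y :* y) u w :+ con (+ 8) :* :z′ y u z) ≈-refl y u w z ⟩
    telescoped (y ⊠ y) u w ⊞ ι (+ 8) ⊠ z′ ∎)
    where
    p q z′ : Carrier
    p = one ⊞ ⊟ y
    q = one ⊞ ⊟ (y ⊠ y)
    -- The old remainder plus one eighth of the difference of the two polynomials, times q².
    z′ = (z ⊞ p ⊠ (⊟ y ⊞ ι (+ 2) ⊠ (y ⊠ y) ⊞ ⊟ (ι (+ 2) ⊠ (u ⊠ (y ⊠ p))))) ⊠ (q ⊠ q)
    -- The parameter `a` is pv or y in `left`, and qw or y² in `right`. One factor of the fourth
    -- power is absorbed into the bracket so that v and w occur only in these products.
    left right : Carrier → Carrier
    left a = ((one ⊞ ι (+ 4) ⊠ u) ⊠ p ⊞ ⊟ (ι (+ 4) ⊠ a)) ⊠ (p ⊠ (p ⊠ p)) ⊠ (q ⊠ q) ⊞ ι (+ 8) ⊠ (z ⊠ (q ⊠ q))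
    right a = ((one ⊞ ι (+ 4) ⊠ u) ⊠ q ⊞ ⊟ (ι (+ 4) ⊠ a)) ⊠ (q ⊠ (q ⊠ q)) ⊞ ι (+ 8) ⊠ z′
    :p :q : ∀ {n} → Polynomial n → Polynomial n
    :p y = con 1ℤ :+ :- y
    :q y = con 1ℤ :+ :- (y :* y)
    :z′ : ∀ {n} (y u z : Polynomial n) → Polynomial n
    :z′ y u z = (z :+ :p y :* (:- y :+ con (+ 2) :* (y :* y) :+ :- (con (+ 2) :* (u :* (y :* :p y))))) :* (:q y :* :q y)
    :left :right : ∀ {n} (y u z a : Polynomial n) → Polynomial n
    :left y u z a = ((con 1ℤ :+ con (+ 4) :* u) :* :p y :+ :- (con (+ 4) :* a)) :* (:p y :* (:p y :* :p y)) :* (:q y :* :q y) :+ con (+ 8) :* (z :* (:q y :* :q y))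
    :right y u z a = ((con 1ℤ :+ con (+ 4) :* u) :* :q y :+ :- (con (+ 4) :* a)) :* (:q y :* (:q y :* :q y)) :+ con (+ 8) :* :z′ y u z

  telescoped-cong : ∀ {y y′ u v} → y ≈ y′ → telescoped y u v ≈ telescoped y′ u v
  telescoped-cong {y} {y′} y≈ = *-congˡ (*-cong (*-cong 1-y 1-y) (*-cong 1-y 1-y))
    where
    1-y : one ⊞ ⊟ y ≈ one ⊞ ⊟ y′
    1-y = +-congˡ (-‿cong y≈)

  -- Initially v = u, so the correction factor is 1, and the fourth power comes from squaring the
  -- doubled factor 1 - x.
  telescoped-start : ∀ {d} y u → d ≈ (one ⊞ ⊟ y) ⊠ (one ⊞ ⊟ y) → d ⊠ d ≈ telescoped y u u ⊞ ι (+ 8) ⊠ ι 0ℤ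
  telescoped-start y u d≈ = ≈-trans (*-cong d≈ d≈)
    (solve 2 (λ y u → ((con 1ℤ :+ :- y) :* (con 1ℤ :+ :- y)) :* ((con 1ℤ :+ :- y) :* (con 1ℤ :+ :- y))
      := :telescoped y u u :+ con (+ 8) :* con 0ℤ) ≈-refl y u)

  -- Once y vanishes, so does v = (1 - y)v = y, and only 1 + 4u survives modulo 8.
  telescoped-end : ∀ y u v z → y ≈ 0# → (one ⊞ ⊟ y) ⊠ v ≈ y → telescoped y u v ⊞ ι (+ 8) ⊠ z ≈ near one u z
  telescoped-end y u v z y≈0 v≈ = begin
    telescoped y u v ⊞ ι (+ 8) ⊠ z
      ≈⟨ +-congʳ (*-cong (+-congˡ (*-congˡ (+-congˡ (-‿cong v≈0)))) (*-cong 1-y² 1-y²)) ⟩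
    (one ⊞ ι (+ 4) ⊠ (u ⊞ ⊟ ι 0ℤ)) ⊠ ((one ⊠ one) ⊠ (one ⊠ one)) ⊞ ι (+ 8) ⊠ z
      ≈⟨ solve 2 (λ u z → (con 1ℤ :+ con (+ 4) :* (u :+ :- con 0ℤ)) :* ((con 1ℤ :* con 1ℤ) :* (con 1ℤ :* con 1ℤ)) :+ con (+ 8) :* z
           := :near (con 1ℤ) u z) ≈-refl u z ⟩
    near one u z ∎
    where
    y≈ι0 : y ≈ ι 0ℤ
    y≈ι0 = ≈-trans y≈0 (≈-sym 0-homo)
    1-y : one ⊞ ⊟ y ≈ one
    1-y = ≈-trans (+-congˡ (-‿cong y≈ι0)) (solve 0 (con 1ℤ :+ :- con 0ℤ := con 1ℤ) ≈-refl)
    1-y² : (one ⊞ ⊟ y) ⊠ (one ⊞ ⊟ y) ≈ one ⊠ one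
    1-y² = *-cong 1-y 1-y
    v≈0 : v ≈ ι 0ℤ
    v≈0 = begin
      v                  ≈⟨ solve 1 (λ v → v := con 1ℤ :* v) ≈-refl v ⟩
      one ⊠ v            ≈⟨ *-congʳ 1-y ⟨
      (one ⊞ ⊟ y) ⊠ v    ≈⟨ v≈ ⟩
      y                  ≈⟨ y≈ι0 ⟩
      ι 0ℤ               ∎

  -- For g = 1/(1 - y) this is g - 1 = y/(1 - y), cleared of its denominator.
  geometric : ∀ {a} y g → a ≈ one ⊞ ⊟ y → a ⊠ g ≈ one → (one ⊞ ⊟ y) ⊠ (g ⊞ ⊟ one) ≈ y
  geometric {a} y g a≈ ag≈1 = begin
    (one ⊞ ⊟ y) ⊠ (g ⊞ ⊟ one)
      ≈⟨ solve 2 (λ y g → (con 1ℤ :+ :- y) :* (g :+ :- con 1ℤ) := (con 1ℤ :+ :- y) :* g :+ (y :+ :- con 1ℤ)) ≈-refl y g ⟩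
    (one ⊞ ⊟ y) ⊠ g ⊞ (y ⊞ ⊟ one)
      ≈⟨ +-congʳ (≈-trans (*-congʳ (≈-sym a≈)) ag≈1) ⟩
    one ⊞ (y ⊞ ⊟ one)
      ≈⟨ solve 1 (λ y → con 1ℤ :+ (y :+ :- con 1ℤ) := y) ≈-refl y ⟩
    y ∎

  -- Powers and finite products

  **-double : ∀ x j → x ** (j ℕ.* 2) ≈ (x ⊠ x) ** j
  **-double x zero    = ≈-refl
  **-double x (suc j) = ≈-trans (≈-sym (*-assoc x x _)) (*-congˡ (**-double x j))

  **-odd : ∀ x j → x ** suc (j ℕ.* 2) ≈ x ⊠ (x ⊠ x) ** j
  **-odd x j = *-congˡ (**-double x j)

  -- Moves an odd power of the inverse up to the next even exponent at the cost of one factor `d`.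
  -- For odd positive m the factor outside the even power is thus D itself, whose coefficients are
  -- differences of Thue-Morse signs.
  inverse-**-odd : ∀ {d e} j → e ⊠ d ≈ one → e ** suc (j ℕ.* 2) ≈ d ⊠ (e ⊠ e) ** suc j
  inverse-**-odd {d} {e} j ed≈1 = ≈-sym (begin
    d ⊠ (e ⊠ e) ** suc j              ≈⟨ *-congˡ (**-double e (suc j)) ⟨
    d ⊠ (e ⊠ e ** suc (j ℕ.* 2))      ≈⟨ *-assoc d e _ ⟨
    d ⊠ e ⊠ e ** suc (j ℕ.* 2)        ≈⟨ *-congʳ (≈-trans (*-comm d e) ed≈1) ⟩
    one ⊠ e ** suc (j ℕ.* 2)          ≈⟨ *-congʳ 1-homo ⟩
    1# ⊠ e ** suc (j ℕ.* 2)           ≈⟨ *-identityˡ _ ⟩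
    e ** suc (j ℕ.* 2)                ∎)

  -- Partial products are specified by their recursion, so that `prodTo m` fits for every m.
  IsProduct : (a P : ℕ → Carrier) → Set
  IsProduct a P = P 0 ≈ a 0 × (∀ i → P (suc i) ≈ P i ⊠ a (suc i))

  product-power : ∀ {a P a′ P′} p → IsProduct a P → IsProduct a′ P′ → (∀ i → a′ i ≈ a i ** p) →
    ∀ i → P′ i ≈ P i ** p
  product-power {a} {P} p (P₀ , P₊) (P′₀ , P′₊) a′≈ zero = ≈-trans P′₀ (≈-trans (a′≈ 0) (^-congˡ p (≈-sym P₀)))
  product-power {a} {P} p P!@(P₀ , P₊) P′!@(P′₀ , P′₊) a′≈ (suc i) = ≈-trans (P′₊ i)
    (≈-trans (*-cong (product-power p P! P′! a′≈ i) (a′≈ (suc i)))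
    (≈-trans (≈-sym (^-distrib-* (P i) (a (suc i)) p)) (^-congˡ p (≈-sym (P₊ i)))))

  full-product-power : ∀ {a P a′ P′} p → IsProduct a P → IsProduct a′ P′ → (∀ i → a′ i ≈ a i ** p) →
    ∀ i → a′ 0 ⊠ P′ i ≈ (a 0 ⊠ P i) ** p
  full-product-power {a} {P} p P! P′! a′≈ i =
    ≈-trans (*-cong (a′≈ 0) (product-power p P! P′! a′≈ i)) (≈-sym (^-distrib-* (a 0) (P i) p))

  one-⊠ : ∀ {x y} → x ≈ one → y ≈ one → x ⊠ y ≈ one
  one-⊠ x≈1 y≈1 = ≈-trans (*-cong x≈1 y≈1) (solve 0 (con 1ℤ :* con 1ℤ := con 1ℤ) ≈-refl)

  -- Here a i, b i, y i stand for 1 - x^(2^i), its inverse and x^(2^i).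
  module Products (a b y P Q : ℕ → Carrier) (a≈ : ∀ i → a i ≈ one ⊞ ⊟ y i) (ab≈1 : ∀ i → a i ⊠ b i ≈ one)
    (y-double : ∀ i → y (suc i) ≈ y i ⊠ y i) (P! : IsProduct a P) (Q! : IsProduct b Q) where

    -- `d i` is D cut off after the i-th factor and `e i` is its inverse; `u i` is y/(1 - y) for y =
    -- x^(2^i), so that `u 0` is x/(1 - x).
    d e u : ℕ → Carrier
    d i = a 0 ⊠ P i
    e i = b 0 ⊠ Q i
    u i = b i ⊞ ⊟ one

    e⊠d : ∀ i → e i ⊠ d i ≈ one
    e⊠d i = ≈-trans (interchange (b 0) (Q i) (a 0) (P i)) (one-⊠ (ba≈1 0) (QP i))
      where
      ba≈1 : ∀ i → b i ⊠ a i ≈ one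
      ba≈1 i = ≈-trans (*-comm (b i) (a i)) (ab≈1 i)
      QP : ∀ i → Q i ⊠ P i ≈ one
      QP zero    = ≈-trans (*-cong (proj₁ Q!) (proj₁ P!)) (ba≈1 0)
      QP (suc i) = ≈-trans (*-cong (proj₂ Q! i) (proj₂ P! i))
        (≈-trans (interchange (Q i) (b (suc i)) (P i) (a (suc i))) (one-⊠ (QP i) (ba≈1 (suc i))))

    u≈ : ∀ i → (one ⊞ ⊟ y i) ⊠ u i ≈ y i
    u≈ i = geometric (y i) (b i) (a≈ i) (ab≈1 i)

    1-y² : ∀ i → one ⊞ ⊟ y (suc i) ≈ one ⊞ ⊟ (y i ⊠ y i)
    1-y² i = +-congˡ (-‿cong (y-double i))

    -- The extra factor 1 - x of `d i` cancels the denominator of x/(1 - x).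
    u⊠d : ∀ i → u 0 ⊠ d i ≈ y 0 ⊠ P i
    u⊠d i = ≈-trans (≈-sym (*-assoc (u 0) (a 0) (P i))) (*-congʳ (≈-trans (*-comm (u 0) (a 0)) (≈-trans (*-congʳ (a≈ 0)) (u≈ 0))))

    d²-telescoped : ∀ i → ∃ λ z → d i ⊠ d i ≈ telescoped (y i) (u 0) (u i) ⊞ ι (+ 8) ⊠ z
    d²-telescoped zero = _ , telescoped-start (y 0) (u 0) (*-cong (a≈ 0) (≈-trans (proj₁ P!) (a≈ 0)))
    d²-telescoped (suc i) =
      let z  , d²≈ = d²-telescoped i
          z′ , eq  = telescope (y i) (u 0) (u i) (u (suc i)) z d²≈ (u≈ i)
                       (≈-trans (*-congʳ (≈-sym (1-y² i))) (≈-trans (u≈ (suc i)) (y-double i)))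
      in  z′ , ≈-trans (*-cong step step) (≈-trans eq (+-congʳ (telescoped-cong (≈-sym (y-double i)))))
      where
      step : d (suc i) ≈ d i ⊠ (one ⊞ ⊟ (y i ⊠ y i))
      step = ≈-trans (*-congˡ (proj₂ P! i)) (≈-trans (≈-sym (*-assoc (a 0) (P i) (a (suc i))))
        (*-congˡ (≈-trans (a≈ (suc i)) (1-y² i))))

    d²-near : ∀ i → y i ≈ 0# → ∃ λ z → d i ⊠ d i ≈ near one (u 0) z
    d²-near i y≈0 with d²-telescoped i
    ... | z , d²≈ = z , ≈-trans d²≈ (telescoped-end (y i) (u 0) (u i) z y≈0 (u≈ i))

    e²-near : ∀ i → y i ≈ 0# → ∃ λ z → e i ⊠ e i ≈ near one (u 0) z
    e²-near i y≈0 =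
      let z , d²≈ = d²-near i y≈0
      in  inverse-near (u 0) z d²≈ (≈-trans (interchange (e i) (e i) (d i) (d i)) (one-⊠ (e⊠d i) (e⊠d i)))

-- Coefficients of the factors

shift-⊛ : ∀ k f g n → (shift k f ⊛ g) n ≡ shift k (f ⊛ g) n
shift-⊛ zero    f g n       = refl
shift-⊛ (suc k) f g zero    = ℤₚ.*-zeroˡ (g 0)
shift-⊛ (suc k) f g (suc n) = begin
  (shift (suc k) f ⊛ g) (suc n)           ≡⟨ ⊛-head (shift (suc k) f) g n ⟩
  0ℤ * g (suc n) + (shift k f ⊛ g) n      ≡⟨ cong₂ _+_ (ℤₚ.*-zeroˡ (g (suc n))) (shift-⊛ k f g n) ⟩
  0ℤ + shift k (f ⊛ g) n                  ≡⟨ ℤₚ.+-identityˡ _ ⟩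
  shift k (f ⊛ g) n                       ∎
  where open ≡-Reasoning

shift-cong : ∀ k → (∀ n → f n ≡ g n) → ∀ n → shift k f n ≡ shift k g n
shift-cong zero    f≡g n       = f≡g n
shift-cong (suc k) f≡g zero    = refl
shift-cong (suc k) f≡g (suc n) = shift-cong k f≡g n

shift-shift : ∀ j k f n → shift j (shift k f) n ≡ shift (j ℕ.+ k) f n
shift-shift zero    k f n       = refl
shift-shift (suc j) k f zero    = refl
shift-shift (suc j) k f (suc n) = shift-shift j k f n

shift-below : ∀ k f n → n < k → shift k f n ≡ 0ℤ
shift-below (suc k) f zero    _         = refl
shift-below (suc k) f (suc n) (s≤s n<k) = shift-below k f n n<k

shift-above : ∀ k f n → shift k f (k ℕ.+ n) ≡ f n
shift-above zero    f n = refl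
shift-above (suc k) f n = shift-above k f n

shift-neg : ∀ k f n → shift k (neg f) n ≡ - shift k f n
shift-neg zero    f n       = refl
shift-neg (suc k) f zero    = refl
shift-neg (suc k) f (suc n) = shift-neg k f n

shift-even : ∀ k f n → shift (k ℕ.* 2) f (n ℕ.* 2) ≡ shift k (λ i → f (i ℕ.* 2)) n
shift-even zero    f n       = refl
shift-even (suc k) f zero    = refl
shift-even (suc k) f (suc n) = shift-even k f n

shift-odd : ∀ k f n → shift (k ℕ.* 2) f (suc (n ℕ.* 2)) ≡ shift k (λ i → f (suc (i ℕ.* 2))) n
shift-odd zero    f n       = refl
shift-odd (suc k) f zero    = refl
shift-odd (suc k) f (suc n) = shift-odd k f n

monomial : ℕ → Series
monomial k = shift k oneS

monomial-⊛ : ∀ k f n → (monomial k ⊛ f) n ≡ shift k f n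
monomial-⊛ k f n = trans (shift-⊛ k oneS f n) (shift-cong k (oneS-⊛ f) n)

monomial-+ : ∀ j k n → (monomial j ⊛ monomial k) n ≡ monomial (j ℕ.+ k) n
monomial-+ j k n = trans (monomial-⊛ j (monomial k) n) (shift-shift j k oneS n)

lin-monomial : ∀ k .{{_ : ℕ.NonZero k}} n → lin k n ≡ (const 1ℤ ⊕ neg (monomial k)) n
lin-monomial (suc k) zero    = refl
lin-monomial (suc k) (suc n) = go k n
  where
  go : ∀ k n → (if n ≡ᵇ k then -[1+ 0 ] else 0ℤ) ≡ 0ℤ + - monomial k n
  go zero    zero    = refl
  go zero    (suc n) = refl
  go (suc k) zero    = refl
  go (suc k) (suc n) = go k n

lin-⊛ : ∀ k .{{_ : ℕ.NonZero k}} f n → (lin k ⊛ f) n ≡ f n - shift k f n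
lin-⊛ k f n = begin
  (lin k ⊛ f) n
    ≡⟨ ⊛-cong-≤ {g = f} n (λ i _ → lin-monomial k i) (λ _ _ → refl) ⟩
  ((const 1ℤ ⊕ neg (monomial k)) ⊛ f) n
    ≡⟨ ⊛-distribʳ f (const 1ℤ) (neg (monomial k)) n ⟩
  (const 1ℤ ⊛ f) n + (neg (monomial k) ⊛ f) n
    ≡⟨ cong₂ _+_ (trans (const-⊛ 1ℤ f n) (ℤₚ.*-identityˡ (f n))) neg-part ⟩
  f n - shift k f n ∎
  where
  open ≡-Reasoning
  neg-part : (neg (monomial k) ⊛ f) n ≡ - shift k f n
  neg-part = begin
    (neg (monomial k) ⊛ f) n
      ≡⟨ ⊛-cong-≤ {g = f} n (λ i _ → sym (ℤₚ.-1*i≡-i (monomial k i))) (λ _ _ → refl) ⟩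
    ((λ i → ℤ.-1ℤ * monomial k i) ⊛ f) n
      ≡⟨ scale-⊛ ℤ.-1ℤ (monomial k) f n ⟩
    ℤ.-1ℤ * (monomial k ⊛ f) n
      ≡⟨ ℤₚ.-1*i≡-i _ ⟩
    - (monomial k ⊛ f) n
      ≡⟨ cong -_ (monomial-⊛ k f n) ⟩
    - shift k f n ∎

geom-yes : ∀ k n → k ∣ n → geom k n ≡ 1ℤ
geom-yes k n k∣n = cong (λ b → if b then 1ℤ else 0ℤ) (dec-true (k ∣? n) k∣n)

-- The recursion G = 1 + x^d G of the geometric series, with d = k + 1: below degree d only 0 is
-- divisible by d, and from there on divisibility by d has period d.
geom-step : ∀ k n → geom (suc k) n ≡ oneS n + shift (suc k) (geom (suc k)) n
geom-step k zero    = geom-yes (suc k) 0 (suc k ∣0)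
geom-step k (suc n) with suc k ℕ.≤? suc n
... | no  k≰n = begin
  geom (suc k) (suc n)
    ≡⟨ cong (λ b → if b then 1ℤ else 0ℤ) (dec-false (suc k ∣? suc n) λ k∣n → k≰n (∣⇒≤ k∣n)) ⟩
  0ℤ
    ≡⟨ cong (λ z → 0ℤ + z) (shift-below (suc k) (geom (suc k)) (suc n) (ℕₚ.≰⇒> k≰n)) ⟨
  0ℤ + shift (suc k) (geom (suc k)) (suc n) ∎
  where open ≡-Reasoning
... | yes k≤n = subst (λ i → geom (suc k) i ≡ 0ℤ + shift (suc k) (geom (suc k)) i) (ℕₚ.m+[n∸m]≡n k≤n) (begin
  geom (suc k) (suc k ℕ.+ r)
    ≡⟨ cong (λ b → if b then 1ℤ else 0ℤ) (does-⇔ (mk⇔ (λ d → ∣m+n∣m⇒∣n d ∣-refl) (∣m∣n⇒∣m+n ∣-refl)) (suc k ∣? suc k ℕ.+ r) (suc k ∣? r)) ⟩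
  geom (suc k) r
    ≡⟨ shift-above (suc k) (geom (suc k)) r ⟨
  shift (suc k) (geom (suc k)) (suc k ℕ.+ r)
    ≡⟨ ℤₚ.+-identityˡ _ ⟨
  0ℤ + shift (suc k) (geom (suc k)) (suc k ℕ.+ r) ∎)
  where
  open ≡-Reasoning
  r = suc n ℕ.∸ suc k

lin-geom : ∀ k .{{_ : ℕ.NonZero k}} n → (lin k ⊛ geom k) n ≡ oneS n
lin-geom (suc k) n = trans (lin-⊛ (suc k) (geom (suc k)) n)
  (trans (cong (_- shift (suc k) (geom (suc k)) n) (geom-step k n)) (cancel (oneS n) _))
  where
  cancel : ∀ a b → (a + b) - b ≡ a
  cancel = solve-∀

-- Thue–Morse signs

-- The coefficients of ∏_{i < N} (1 - x^(2^i)).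
partial : ℕ → Series
partial zero    n = oneS n
partial (suc N) n = partial N n - shift (2 ^ N) (partial N) n

n<2^n : ∀ n → n < 2 ^ n
n<2^n zero    = s≤s z≤n
n<2^n (suc n) = ℕₚ.≤-trans (ℕₚ.+-mono-≤ (ℕₚ.m^n>0 2 n) (n<2^n n)) (ℕₚ.≤-reflexive (cong (2 ^ n ℕ.+_) (sym (ℕₚ.+-identityʳ (2 ^ n)))))

-- Factors from the N-th on alter only degrees at least 2^N.
partial-stable : ∀ j N n → n < 2 ^ N → partial (j ℕ.+ N) n ≡ partial N n
partial-stable zero    N n n<2^N = refl
partial-stable (suc j) N n n<2^N = begin
  partial (j ℕ.+ N) n - shift (2 ^ (j ℕ.+ N)) (partial (j ℕ.+ N)) n
    ≡⟨ cong (λ z → partial (j ℕ.+ N) n - z) (shift-below _ _ n (ℕₚ.<-≤-trans n<2^N (ℕₚ.^-monoʳ-≤ 2 (ℕₚ.m≤n+m N j)))) ⟩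
  partial (j ℕ.+ N) n - 0ℤ
    ≡⟨ ℤₚ.+-identityʳ _ ⟩
  partial (j ℕ.+ N) n
    ≡⟨ partial-stable j N n n<2^N ⟩
  partial N n ∎
  where open ≡-Reasoning

-- The first N + 1 factors multiply to 1 - x times the product of the first N factors taken at x².
-- The induction removes the last factor, whose exponent is even, so that its shift stays within one
-- parity class.
partial-even : ∀ N n → partial (suc N) (n ℕ.* 2) ≡ partial N n
partial-even zero    zero    = refl
partial-even zero    (suc n) = refl
partial-even (suc N) n = cong₂ _-_ (partial-even N n) (begin
  shift (2 ^ suc N) (partial (suc N)) (n ℕ.* 2)        ≡⟨ cong (λ k → shift k (partial (suc N)) (n ℕ.* 2)) (ℕₚ.*-comm 2 (2 ^ N)) ⟩
  shift (2 ^ N ℕ.* 2) (partial (suc N)) (n ℕ.* 2)      ≡⟨ shift-even (2 ^ N) (partial (suc N)) n ⟩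
  shift (2 ^ N) (λ i → partial (suc N) (i ℕ.* 2)) n    ≡⟨ shift-cong (2 ^ N) (partial-even N) n ⟩
  shift (2 ^ N) (partial N) n                          ∎)
  where open ≡-Reasoning

partial-odd : ∀ N n → partial (suc N) (suc (n ℕ.* 2)) ≡ - partial N n
partial-odd zero    zero    = refl
partial-odd zero    (suc n) = refl
partial-odd (suc N) n = trans (cong₂ _-_ (partial-odd N n) (begin
  shift (2 ^ suc N) (partial (suc N)) (suc (n ℕ.* 2))      ≡⟨ cong (λ k → shift k (partial (suc N)) (suc (n ℕ.* 2))) (ℕₚ.*-comm 2 (2 ^ N)) ⟩
  shift (2 ^ N ℕ.* 2) (partial (suc N)) (suc (n ℕ.* 2))    ≡⟨ shift-odd (2 ^ N) (partial (suc N)) n ⟩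
  shift (2 ^ N) (λ i → partial (suc N) (suc (i ℕ.* 2))) n  ≡⟨ shift-cong (2 ^ N) (partial-odd N) n ⟩
  shift (2 ^ N) (neg (partial N)) n                        ≡⟨ shift-neg (2 ^ N) (partial N) n ⟩
  - shift (2 ^ N) (partial N) n                            ∎))
  (sym (ℤₚ.neg-distrib-+ (partial N n) (- shift (2 ^ N) (partial N) n)))
  where open ≡-Reasoning

data Parity : ℕ → Set where
  even : ∀ k → Parity (k ℕ.* 2)
  odd  : ∀ k → Parity (suc (k ℕ.* 2))

parity : ∀ n → Parity n
parity zero    = even 0
parity (suc n) with parity n
... | even k = odd k
... | odd k  = even (suc k)

Sign : ℤ → Set
Sign a = a ≡ 1ℤ ⊎ a ≡ ℤ.-1ℤ

neg-sign : ∀ {a} → Sign a → Sign (- a)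
neg-sign (inj₁ refl) = inj₂ refl
neg-sign (inj₂ refl) = inj₁ refl

-- By the two parity rules each binary digit of n contributes only a sign. The product has degree
-- 2^N - 1, hence the bound, which halves along with n.
partial-sign : ∀ N n → n < 2 ^ N → Sign (partial N n)
partial-sign zero    zero    _ = inj₁ refl
partial-sign zero    (suc n) (s≤s ())
partial-sign (suc N) n n<2^ with parity n
... | even k = subst Sign (sym (partial-even N k))
  (partial-sign N k (ℕₚ.*-cancelʳ-< 2 k (2 ^ N) (subst (k ℕ.* 2 <_) (ℕₚ.*-comm 2 (2 ^ N)) n<2^)))
... | odd k = subst Sign (sym (partial-odd N k)) (neg-sign
  (partial-sign N k (ℕₚ.*-cancelʳ-< 2 k (2 ^ N) (ℕₚ.<-trans (ℕₚ.n<1+n (k ℕ.* 2)) (subst (suc (k ℕ.* 2) <_) (ℕₚ.*-comm 2 (2 ^ N)) n<2^)))))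

-- As n < 2^n, the coefficient in degree n no longer changes after stage n. It is -1 to the power of
-- the binary digit sum of n.
thueMorse : Series
thueMorse n = partial n n

thueMorse-sign : ∀ n → Sign (thueMorse n)
thueMorse-sign n = partial-sign n n (n<2^n n)

partial-thueMorse : ∀ N n → n ≤ N → partial N n ≡ thueMorse n
partial-thueMorse N n n≤N =
  trans (cong (λ M → partial M n) (sym (ℕₚ.m∸n+n≡m n≤N))) (partial-stable (N ℕ.∸ n) n n (n<2^n n))

n≤n*2 : ∀ n → n ≤ n ℕ.* 2
n≤n*2 n = ℕₚ.m≤m*n n 2

thueMorse-even : ∀ n → thueMorse (n ℕ.* 2) ≡ thueMorse n
thueMorse-even zero    = refl
thueMorse-even (suc n) = trans (partial-even (suc (n ℕ.* 2)) (suc n)) (partial-thueMorse _ (suc n) (s≤s (n≤n*2 n)))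

thueMorse-odd : ∀ n → thueMorse (suc (n ℕ.* 2)) ≡ - thueMorse n
thueMorse-odd n = trans (partial-odd (n ℕ.* 2) n) (cong -_ (partial-thueMorse _ n (n≤n*2 n)))

-- Sign changes and their 2-kernel

changes : ℕ → Bool
changes n = not (does (thueMorse (suc n) ℤ.≟ thueMorse n))

changes-even : ∀ n → changes (n ℕ.* 2) ≡ true
changes-even n rewrite thueMorse-odd n | thueMorse-even n with thueMorse n | thueMorse-sign n
... | _ | inj₁ refl = refl
... | _ | inj₂ refl = refl

-- The terms at 2n + 1 and 2n + 2 are -t(n) and t(n + 1), so a change at n turns into agreement and
-- conversely.
changes-odd : ∀ n → changes (suc (n ℕ.* 2)) ≡ not (changes n)
changes-odd n rewrite thueMorse-even (suc n) | thueMorse-odd n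
  with thueMorse n | thueMorse-sign n | thueMorse (suc n) | thueMorse-sign (suc n)
... | _ | inj₁ refl | _ | inj₁ refl = refl
... | _ | inj₁ refl | _ | inj₂ refl = refl
... | _ | inj₂ refl | _ | inj₁ refl = refl
... | _ | inj₂ refl | _ | inj₂ refl = refl

-- Read the i binary digits of j from the lowest one. A digit 0 makes the subsequence constant, a
-- digit 1 negates what the remaining digits give; so only constants, p and its complement arise.
kernel-shape : ∀ (p : ℕ → Bool) → (∀ n → p (n ℕ.* 2) ≡ true) → (∀ n → p (suc (n ℕ.* 2)) ≡ not (p n)) →
  ∀ i j → j < 2 ^ i →
  (∃ λ b → ∀ n → p (2 ^ i ℕ.* n ℕ.+ j) ≡ b) ⊎ (∃ λ b → ∀ n → p (2 ^ i ℕ.* n ℕ.+ j) ≡ b xor p n)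
kernel-shape p p-even p-odd zero zero _ = inj₂ (false , λ n → cong p (trans (ℕₚ.+-identityʳ _) (ℕₚ.+-identityʳ n)))
kernel-shape p p-even p-odd zero (suc j) (s≤s ())
kernel-shape p p-even p-odd (suc i) j j<2^ with parity j
... | even k = inj₁ (true , λ n → trans (cong p (split n)) (p-even (2 ^ i ℕ.* n ℕ.+ k)))
  where
  split : ∀ n → 2 ^ suc i ℕ.* n ℕ.+ k ℕ.* 2 ≡ (2 ^ i ℕ.* n ℕ.+ k) ℕ.* 2
  split n = halve (2 ^ i) n k
    where
    halve : ∀ a n k → (2 ℕ.* a) ℕ.* n ℕ.+ k ℕ.* 2 ≡ (a ℕ.* n ℕ.+ k) ℕ.* 2
    halve = ℕ-solve-∀
... | odd k with kernel-shape p p-even p-odd i k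
  (ℕₚ.*-cancelʳ-< 2 k (2 ^ i) (ℕₚ.<-trans (ℕₚ.n<1+n (k ℕ.* 2)) (subst (suc (k ℕ.* 2) <_) (ℕₚ.*-comm 2 (2 ^ i)) j<2^)))
... | r = step r
  where
  halve : ∀ a n k → (2 ℕ.* a) ℕ.* n ℕ.+ suc (k ℕ.* 2) ≡ suc ((a ℕ.* n ℕ.+ k) ℕ.* 2)
  halve = ℕ-solve-∀
  reduce : ∀ n → p (2 ^ suc i ℕ.* n ℕ.+ suc (k ℕ.* 2)) ≡ not (p (2 ^ i ℕ.* n ℕ.+ k))
  reduce n = trans (cong p (halve (2 ^ i) n k)) (p-odd _)
  step : _ → _
  step (inj₁ (b , q)) = inj₁ (not b , λ n → trans (reduce n) (cong not (q n)))
  step (inj₂ (b , q)) = inj₂ (not b , λ n → trans (reduce n) (trans (cong not (q n)) (not-xor b (p n))))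
    where
    not-xor : ∀ a b → not (a xor b) ≡ not a xor b
    not-xor true  true  = refl
    not-xor true  false = refl
    not-xor false _     = refl

-- The listed sequences are the images under `v` of the two constants, of p and of its complement,
-- which exhaust the kernel by `kernel-shape`.
automatic : {A : Set} (p : ℕ → Bool) → (∀ n → p (n ℕ.* 2) ≡ true) → (∀ n → p (suc (n ℕ.* 2)) ≡ not (p n)) →
  (v : Bool → A) (e : ℕ → A) → (∀ n → e n ≡ v (p n)) → Automatic 2 e
automatic p p-even p-odd v e e≡ =
  (λ _ → v true) ∷ (λ _ → v false) ∷ (λ n → v (p n)) ∷ (λ n → v (not (p n))) ∷ [] ,
  λ i j j<2^i → place i j (kernel-shape p p-even p-odd i j j<2^i)
  where
  place : ∀ i j → _ → _
  place i j (inj₁ (true  , q)) = here λ n → sym (trans (e≡ _) (cong v (q n)))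
  place i j (inj₁ (false , q)) = there (here λ n → sym (trans (e≡ _) (cong v (q n))))
  place i j (inj₂ (false , q)) = there (there (here λ n → sym (trans (e≡ _) (cong v (q n)))))
  place i j (inj₂ (true  , q)) = there (there (there (here λ n → sym (trans (e≡ _) (cong v (q n))))))

-- 2-adic valuations

ν2ℕ-go-odd : ∀ fuel n → n % 2 ≡ 1 → ν2ℕ-go (suc fuel) n ≡ 0
ν2ℕ-go-odd fuel n eq rewrite eq = refl

ν2ℕ-go-even : ∀ fuel n → n % 2 ≡ 0 → ν2ℕ-go (suc fuel) n ≡ suc (ν2ℕ-go fuel (n / 2))
ν2ℕ-go-even fuel n eq rewrite eq = refl

-- Each unit of fuel strips one factor 2, and with one more unit the odd cofactor is tested and
-- stops the recursion.
ν2ℕ-go-exact : ∀ fuel s k → s < fuel → ν2ℕ-go fuel (2 ^ s ℕ.* suc (k ℕ.* 2)) ≡ s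
ν2ℕ-go-exact (suc fuel) zero k _ =
  ν2ℕ-go-odd fuel (1 ℕ.* suc (k ℕ.* 2)) (trans (cong (_% 2) (ℕₚ.*-identityˡ (suc (k ℕ.* 2)))) ([m+kn]%n≡m%n 1 k 2))
ν2ℕ-go-exact (suc fuel) (suc s) k (s≤s s<fuel) = begin
  ν2ℕ-go (suc fuel) (2 ^ suc s ℕ.* suc (k ℕ.* 2))  ≡⟨ cong (ν2ℕ-go (suc fuel)) (trans (ℕₚ.*-assoc 2 (2 ^ s) _) (ℕₚ.*-comm 2 half)) ⟩
  ν2ℕ-go (suc fuel) (half ℕ.* 2)                   ≡⟨ ν2ℕ-go-even fuel (half ℕ.* 2) (m*n%n≡0 half 2) ⟩
  suc (ν2ℕ-go fuel (half ℕ.* 2 / 2))               ≡⟨ cong (λ n → suc (ν2ℕ-go fuel n)) (m*n/n≡m half 2) ⟩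
  suc (ν2ℕ-go fuel half)                           ≡⟨ cong suc (ν2ℕ-go-exact fuel s k s<fuel) ⟩
  suc s                                            ∎
  where
  open ≡-Reasoning
  half = 2 ^ s ℕ.* suc (k ℕ.* 2)

ν₂-abs : ∀ a n .{{_ : ℕ.NonZero n}} → ℤ.∣ a ∣ ≡ n → ν₂ a ≡ just (ν2ℕ-go n n)
ν₂-abs a (suc n) eq with ℤ.∣ a ∣ | eq
... | suc .n | refl = refl

-- Were the absolute value even, 2 would divide the sign `a`.
∣sign+even∣ : ∀ a z → Sign a → ∃ λ k → ℤ.∣ a + + 2 * z ∣ ≡ suc (k ℕ.* 2)
∣sign+even∣ a z sign = decide (ℤ.∣ a + + 2 * z ∣) (parity _) refl
  where
  2∤sign : ∀ {a} → Sign a → ¬ (2 ∣ ℤ.∣ a ∣)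
  2∤sign (inj₁ refl) = from-no (2 ∣? 1)
  2∤sign (inj₂ refl) = from-no (2 ∣? 1)
  decide : ∀ n → Parity n → ℤ.∣ a + + 2 * z ∣ ≡ n → ∃ λ k → ℤ.∣ a + + 2 * z ∣ ≡ suc (k ℕ.* 2)
  decide _ (odd k)  eq = k , eq
  decide _ (even k) eq = contradiction
    (∣⇒∣ᵤ {+ 2} {a} (∣m+n∣n⇒∣m {+ 2} {a} {+ 2 * z} (∣ᵤ⇒∣ {+ 2} {a + + 2 * z} (divides k eq)) (∣m⇒∣m*n {+ 2} {+ 2} z (∣ₛ-refl {+ 2}))))
    (2∤sign {a} sign)

ν₂-exact : ∀ s a z → Sign a → ν₂ (+ (2 ^ s) * (a + + 2 * z)) ≡ just s
ν₂-exact s a z sign with ∣sign+even∣ a z sign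
... | k , eq = trans (ν₂-abs (+ (2 ^ s) * (a + + 2 * z)) m {{m≢0}} (trans (ℤₚ.abs-* (+ (2 ^ s)) (a + + 2 * z)) (cong (2 ^ s ℕ.*_) eq)))
                     -- `ν₂` takes the number itself as fuel, which suffices since s < 2^s ≤ m.
                     (cong just (ν2ℕ-go-exact m s k (ℕₚ.<-≤-trans (n<2^n s) (ℕₚ.m≤m*n (2 ^ s) (suc (k ℕ.* 2))))))
  where
  m = 2 ^ s ℕ.* suc (k ℕ.* 2)
  m≢0 : ℕ.NonZero m
  m≢0 = ℕₚ.m*n≢0 (2 ^ s) (suc (k ℕ.* 2)) {{ℕₚ.m^n≢0 2 s}}

-- The product and its powers

-- `c m n` is `full m n n`. Keeping the stage N apart from the degree lets ring identities speak
-- about one fixed series.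
full : ℤ → ℕ → Series
full m N = factor m 1 ⊛ prodTo m N

factor-neg : ∀ k n → factor -[1+ 0 ] k n ≡ lin k n
factor-neg k n = trans (⊛-comm (lin k) oneS n) (oneS-⊛ (lin k) n)

-- `prodTo` includes the factor with i = N, whereas `partial N` stops just before it; hence the
-- shifted index.
prodTo-partial : ∀ N n → prodTo -[1+ 0 ] N n ≡ partial (suc N) n
prodTo-partial zero    n = lin-⊛ 1 oneS n
prodTo-partial (suc N) n = begin
  prodTo -[1+ 0 ] (suc N) n
    ≡⟨ ⊛-cong-≤ {f = prodTo -[1+ 0 ] N} {f′ = partial (suc N)} {g = factor -[1+ 0 ] (2 ^ suc N)} {g′ = lin (2 ^ suc N)} n
         (λ k _ → prodTo-partial N k) (λ k _ → factor-neg (2 ^ suc N) k) ⟩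
  (partial (suc N) ⊛ lin (2 ^ suc N)) n
    ≡⟨ ⊛-comm (partial (suc N)) (lin (2 ^ suc N)) n ⟩
  (lin (2 ^ suc N) ⊛ partial (suc N)) n
    ≡⟨ lin-⊛ (2 ^ suc N) {{ℕₚ.m^n≢0 2 (suc N)}} (partial (suc N)) n ⟩
  partial (suc (suc N)) n ∎
  where open ≡-Reasoning

prodTo-thueMorse : ∀ N n → n ≤ N → prodTo -[1+ 0 ] N n ≡ thueMorse n
prodTo-thueMorse N n n≤N = trans (prodTo-partial N n) (partial-thueMorse (suc N) n (ℕₚ.m≤n⇒m≤1+n n≤N))

-- The additional factor 1 - x turns the Thue-Morse signs into their first differences.
full-thueMorse : ∀ N n → suc n ≤ N → full -[1+ 0 ] N (suc n) ≡ thueMorse (suc n) - thueMorse n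
full-thueMorse N n n<N = begin
  full -[1+ 0 ] N (suc n)
    ≡⟨ ⊛-cong-≤ {f = factor -[1+ 0 ] 1} {f′ = lin 1} {g = prodTo -[1+ 0 ] N} {g′ = prodTo -[1+ 0 ] N} (suc n)
         (λ k _ → factor-neg 1 k) (λ _ _ → refl) ⟩
  (lin 1 ⊛ prodTo -[1+ 0 ] N) (suc n)
    ≡⟨ lin-⊛ 1 (prodTo -[1+ 0 ] N) (suc n) ⟩
  prodTo -[1+ 0 ] N (suc n) - prodTo -[1+ 0 ] N n
    ≡⟨ cong₂ _-_ (prodTo-thueMorse N (suc n) n<N) (prodTo-thueMorse N n (ℕₚ.<⇒≤ n<N)) ⟩
  thueMorse (suc n) - thueMorse n ∎
  where open ≡-Reasoning

-- Valuations of the coefficients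

4*2^s : ∀ s → + (2 ^ (2 ℕ.+ s)) ≡ + 4 * + (2 ^ s)
4*2^s s = trans (cong +_ (sym (ℕₚ.*-assoc 2 2 (2 ^ s)))) (ℤₚ.pos-* 4 (2 ^ s))

const-const-⊛ : ∀ a b f n → (const a ⊛ (const b ⊛ f)) n ≡ a * (b * f n)
const-const-⊛ a b f n = trans (const-⊛ a (const b ⊛ f) n) (cong (a *_) (const-⊛ b f n))

module Coefficients (K : ℕ) where

  open CommutativeRing (truncated K) using (_≈_; *-congˡ; *-cong; 0#) renaming (_*_ to _⊠_; refl to ≈-refl; trans to ≈-trans)
  open Congruences (truncated K) (constants K)
  open import Algebra.Properties.CommutativeSemiring.Exp (CommutativeRing.commutativeSemiring (truncated K)) using () renaming (_^_ to _**_)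

  factors : ℤ → ℕ → Series
  factors m i = factor m (2 ^ i)

  prodTo-product : ∀ m → IsProduct (factors m) (prodTo m)
  prodTo-product m = ≈-refl , λ i → ≈-refl

  powS-** : ∀ f g p → (∀ n → f n ≡ g n) → powS f p ≈ g ** p
  powS-** f g zero    f≡g = ≈-refl
  powS-** f g (suc p) f≡g = *-cong {f} {g} {powS f p} {g ** p} (everywhere f≡g) (powS-** f g p f≡g)

  factor-pos : ∀ k n → factor (+ 1) k n ≡ geom k n
  factor-pos k n = trans (⊛-comm (geom k) oneS n) (oneS-⊛ (geom k) n)

  full-pos : ∀ p N → full (+ p) N ≈ full (+ 1) N ** p
  full-pos p = full-product-power {factors (+ 1)} {prodTo (+ 1)} {factors (+ p)} {prodTo (+ p)} p
    (prodTo-product (+ 1)) (prodTo-product (+ p))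
    (λ i → powS-** (geom (2 ^ i)) (factor (+ 1) (2 ^ i)) p λ n → sym (factor-pos (2 ^ i) n))

  full-neg : ∀ q N → full -[1+ q ] N ≈ full -[1+ 0 ] N ** suc q
  full-neg q = full-product-power {factors -[1+ 0 ]} {prodTo -[1+ 0 ]} {factors -[1+ q ]} {prodTo -[1+ q ]} (suc q)
    (prodTo-product -[1+ 0 ]) (prodTo-product -[1+ q ])
    (λ i → powS-** (lin (2 ^ i)) (factor -[1+ 0 ] (2 ^ i)) (suc q) λ n → sym (factor-neg (2 ^ i) n))

  factor-inverse : ∀ k .{{_ : ℕ.NonZero k}} n → (factor -[1+ 0 ] k ⊛ factor (+ 1) k) n ≡ oneS n
  factor-inverse k n = trans
    (⊛-cong-≤ {f = factor -[1+ 0 ] k} {f′ = lin k} {g = factor (+ 1) k} {g′ = geom k} n (λ i _ → factor-neg k i) (λ i _ → factor-pos k i))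
    (lin-geom k n)

  open Products (factors -[1+ 0 ]) (factors (+ 1)) (λ i → monomial (2 ^ i)) (prodTo -[1+ 0 ]) (prodTo (+ 1))
    (λ i → everywhere λ n → trans (factor-neg (2 ^ i) n) (lin-monomial (2 ^ i) {{ℕₚ.m^n≢0 2 i}} n))
    (λ i → everywhere λ n → trans (factor-inverse (2 ^ i) {{ℕₚ.m^n≢0 2 i}} n) (sym (const-1 n)))
    (λ i → everywhere λ n → trans (cong (λ k → monomial (2 ^ i ℕ.+ k) n) (ℕₚ.+-identityʳ (2 ^ i))) (sym (monomial-+ (2 ^ i) (2 ^ i) n)))
    (prodTo-product -[1+ 0 ]) (prodTo-product (+ 1))

  monomial-vanishes : ∀ N → K ≤ 2 ^ N → monomial (2 ^ N) ≈ 0#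
  monomial-vanishes N K≤ = below λ n n<K → trans (shift-below (2 ^ N) oneS n (ℕₚ.<-≤-trans n<K K≤)) (const-0 n)
    where
    const-0 : ∀ n → 0ℤ ≡ const 0ℤ n
    const-0 zero    = refl
    const-0 (suc n) = refl

  -- Normal forms that treat both signs of m alike: x is D² or its inverse, and j is half of |m| for
  -- even m and half of |m + 1| for odd m.
  Even Odd : ℕ → ℕ → Series → Set
  Even N j f = ∃ λ x → ∃ λ z → x ≈ near one (u 0) z × f ≈ x ** j
  Odd  N j f = ∃ λ x → ∃ λ z → x ≈ near one (u 0) z × f ≈ full -[1+ 0 ] N ⊠ x ** j

  pos-even : ∀ N k → K ≤ 2 ^ N → Even N k (full (+ (k ℕ.* 2)) N)
  pos-even N k K≤ = let z , e²≈ = e²-near N (monomial-vanishes N K≤) in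
    e N ⊠ e N , z , e²≈ , ≈-trans {full (+ (k ℕ.* 2)) N} {e N ** (k ℕ.* 2)} {(e N ⊠ e N) ** k} (full-pos (k ℕ.* 2) N) (**-double (e N) k)

  pos-odd : ∀ N k → K ≤ 2 ^ N → Odd N (suc k) (full (+ suc (k ℕ.* 2)) N)
  pos-odd N k K≤ = let z , e²≈ = e²-near N (monomial-vanishes N K≤) in
    e N ⊠ e N , z , e²≈ , ≈-trans {full (+ suc (k ℕ.* 2)) N} {e N ** suc (k ℕ.* 2)} {d N ⊠ (e N ⊠ e N) ** suc k}
      (full-pos (suc (k ℕ.* 2)) N) (inverse-**-odd {d N} {e N} k (e⊠d N))

  neg-even : ∀ N k → K ≤ 2 ^ N → Even N (suc k) (full -[1+ suc (k ℕ.* 2) ] N)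
  neg-even N k K≤ = let z , d²≈ = d²-near N (monomial-vanishes N K≤) in
    d N ⊠ d N , z , d²≈ , ≈-trans {full -[1+ suc (k ℕ.* 2) ] N} {d N ** (suc k ℕ.* 2)} {(d N ⊠ d N) ** suc k}
      (full-neg (suc (k ℕ.* 2)) N) (**-double (d N) (suc k))

  neg-odd : ∀ N k → K ≤ 2 ^ N → Odd N k (full -[1+ k ℕ.* 2 ] N)
  neg-odd N k K≤ = let z , d²≈ = d²-near N (monomial-vanishes N K≤) in
    d N ⊠ d N , z , d²≈ , ≈-trans {full -[1+ k ℕ.* 2 ] N} {d N ** suc (k ℕ.* 2)} {d N ⊠ (d N ⊠ d N) ** k}
      (full-neg (k ℕ.* 2) N) (**-odd (d N) k)

  -- Every coefficient of x/(1 - x) in positive degree is 1, so there 1 + 4bu + 8bw has coefficients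
  -- 4b times an odd number.
  even-coeff : ∀ s o N f → Even N (2 ^ s ℕ.* suc (o ℕ.* 2)) f → ∀ n → suc n < K →
    ∃ λ w → f (suc n) ≡ + (2 ^ (2 ℕ.+ s)) * (1ℤ + + 2 * w)
  even-coeff s o N f (x , z , x≈ , f≈) n n<K = w (suc n) , (begin
    f (suc n)
      ≡⟨ trans (coeff f≈ (suc n) n<K) (coeff (proj₂ x^j) (suc n) n<K) ⟩
    -- The leading `0ℤ` is the coefficient of the series 1 in positive degree.
    0ℤ + (const (+ 4) ⊛ (const b ⊛ u 0)) (suc n) + (const (+ 8) ⊛ (const b ⊛ w)) (suc n)
      ≡⟨ cong₂ (λ p q → 0ℤ + p + q)
           (trans (const-const-⊛ (+ 4) b (u 0) (suc n)) (cong (λ y → + 4 * (b * (y + 0ℤ))) (trans (factor-pos 1 (suc n)) (geom-yes 1 (suc n) (1∣ suc n)))))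
           (const-const-⊛ (+ 8) b w (suc n)) ⟩
    0ℤ + + 4 * (b * 1ℤ) + + 8 * (b * w (suc n))
      ≡⟨ factorise b (w (suc n)) ⟩
    + 4 * b * (1ℤ + + 2 * w (suc n))
      ≡⟨ cong (_* (1ℤ + + 2 * w (suc n))) (4*2^s s) ⟨
    + (2 ^ (2 ℕ.+ s)) * (1ℤ + + 2 * w (suc n)) ∎)
    where
    open ≡-Reasoning
    b = + (2 ^ s)
    x^j = power {x} (u 0) z x≈ s o
    w = proj₁ x^j
    factorise : ∀ b w → 0ℤ + + 4 * (b * 1ℤ) + + 8 * (b * w) ≡ + 4 * b * (1ℤ + + 2 * w)
    factorise = solve-∀

  -- In D(1 + 4bu + 8bw), the series D contributes the difference of signs, and uD, which is x times
  -- the Thue-Morse series, contributes the sign at n.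
  odd-coeff : ∀ s o N f → Odd N (2 ^ s ℕ.* suc (o ℕ.* 2)) f → ∀ n → suc n < K → suc n ≤ N →
    ∃ λ w → f (suc n) ≡ thueMorse (suc n) - thueMorse n + + 4 * (+ (2 ^ s) * thueMorse n) + + 8 * (+ (2 ^ s) * w)
  odd-coeff s o N f (x , z , x≈ , f≈) n n<K n<N = (d N ⊛ w) (suc n) , (begin
    f (suc n)
      ≡⟨ coeff f≈ (suc n) n<K ⟩
    (d N ⊛ (x ** j)) (suc n)
      ≡⟨ coeff (*-congˡ {d N} {x ** j} {near (const b) (u 0) w} (proj₂ x^j)) (suc n) n<K ⟩
    (d N ⊛ near (const b) (u 0) w) (suc n)
      ≡⟨ coeff (multiply-near (d N) (const b) (u 0) w) (suc n) n<K ⟩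
    d N (suc n) + (const (+ 4) ⊛ (const b ⊛ (u 0 ⊛ d N))) (suc n) + (const (+ 8) ⊛ (const b ⊛ (d N ⊛ w))) (suc n)
      ≡⟨ cong₂ _+_ (cong₂ _+_ (full-thueMorse N n n<N)
           (trans (const-const-⊛ (+ 4) b (u 0 ⊛ d N) (suc n)) (cong (λ y → + 4 * (b * y)) ud)))
           (const-const-⊛ (+ 8) b (d N ⊛ w) (suc n)) ⟩
    thueMorse (suc n) - thueMorse n + + 4 * (b * thueMorse n) + + 8 * (b * (d N ⊛ w) (suc n)) ∎)
    where
    open ≡-Reasoning
    b = + (2 ^ s)
    j = 2 ^ s ℕ.* suc (o ℕ.* 2)
    x^j = power {x} (u 0) z x≈ s o
    w = proj₁ x^j
    ud : (u 0 ⊛ d N) (suc n) ≡ thueMorse n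
    ud = begin
      (u 0 ⊛ d N) (suc n)                      ≡⟨ coeff (u⊠d N) (suc n) n<K ⟩
      (monomial 1 ⊛ prodTo -[1+ 0 ] N) (suc n) ≡⟨ monomial-⊛ 1 (prodTo -[1+ 0 ] N) (suc n) ⟩
      prodTo -[1+ 0 ] N n                      ≡⟨ prodTo-thueMorse N n (ℕₚ.<⇒≤ n<N) ⟩
      thueMorse n                              ∎

ν₂-even : ∀ s o m → (∀ N → Coefficients.Even (suc N) N (2 ^ s ℕ.* suc (o ℕ.* 2)) (full m N)) →
  ∀ n → ν₂ (c m (suc n)) ≡ just (2 ℕ.+ s)
ν₂-even s o m even-m n =
  -- At stage N = n + 1 the coefficient in degree N is `c m (suc n)`, and truncation at K = N + 1
  -- just retains this degree.
  let w , eq = Coefficients.even-coeff (suc (suc n)) s o (suc n) (full m (suc n)) (even-m (suc n)) n ℕₚ.≤-refl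
  in  trans (cong ν₂ eq) (ν₂-exact (2 ℕ.+ s) 1ℤ w (inj₁ refl))

ν₂-odd : ∀ s o m → (∀ N → Coefficients.Odd (suc N) N (2 ^ s ℕ.* suc (o ℕ.* 2)) (full m N)) →
  ∀ n → ν₂ (c m (suc n)) ≡ (if changes n then just 1 else just (2 ℕ.+ s))
ν₂-odd s o m odd-m n =
  let w , eq = Coefficients.odd-coeff (suc (suc n)) s o (suc n) (full m (suc n)) (odd-m (suc n)) n ℕₚ.≤-refl ℕₚ.≤-refl
  in  trans (cong ν₂ eq) (go w)
  where
  b = + (2 ^ s)
  -- Equal signs cancel and leave 4b times an odd number. Opposite signs add up to -2a, so exactly
  -- one factor 2 splits off.
  equal : ∀ b a w → a - a + + 4 * (b * a) + + 8 * (b * w) ≡ + 4 * b * (a + + 2 * w)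
  equal = solve-∀
  opposite : ∀ b a w → - a - a + + 4 * (b * a) + + 8 * (b * w) ≡ + 2 * (- a + + 2 * (b * a + + 2 * (b * w)))
  opposite = solve-∀
  same : ∀ a w → Sign a → ν₂ (a - a + + 4 * (b * a) + + 8 * (b * w)) ≡ just (2 ℕ.+ s)
  same a w sign = trans (cong ν₂ (trans (equal b a w) (cong (_* (a + + 2 * w)) (sym (4*2^s s))))) (ν₂-exact (2 ℕ.+ s) a w sign)
  flip : ∀ a w → Sign a → ν₂ (- a - a + + 4 * (b * a) + + 8 * (b * w)) ≡ just 1
  flip a w sign = trans (cong ν₂ (opposite b a w)) (ν₂-exact 1 (- a) (b * a + + 2 * (b * w)) (neg-sign sign))
  go : ∀ w → ν₂ (thueMorse (suc n) - thueMorse n + + 4 * (b * thueMorse n) + + 8 * (b * w)) ≡ (if changes n then just 1 else just (2 ℕ.+ s))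
  go w with thueMorse (suc n) | thueMorse-sign (suc n) | thueMorse n | thueMorse-sign n
  ... | _ | inj₁ refl | _ | inj₁ refl = same 1ℤ w (inj₁ refl)
  ... | _ | inj₁ refl | _ | inj₂ refl = flip ℤ.-1ℤ w (inj₂ refl)
  ... | _ | inj₂ refl | _ | inj₁ refl = flip 1ℤ w (inj₁ refl)
  ... | _ | inj₂ refl | _ | inj₂ refl = same ℤ.-1ℤ w (inj₂ refl)

-- Odd part of the exponent and the cases of m

odd-part : ∀ j → ∃ λ s → ∃ λ o → suc j ≡ 2 ^ s ℕ.* suc (o ℕ.* 2)
odd-part = <-rec _ split
  where
  split : ∀ j → (∀ {i} → i < j → ∃ λ s → ∃ λ o → suc i ≡ 2 ^ s ℕ.* suc (o ℕ.* 2)) →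
    ∃ λ s → ∃ λ o → suc j ≡ 2 ^ s ℕ.* suc (o ℕ.* 2)
  split j rec with parity j
  ... | even k = 0 , k , sym (ℕₚ.*-identityˡ (suc (k ℕ.* 2)))
  -- Here suc j = 2(k + 1), so the recursion continues at k.
  ... | odd k with rec (s≤s (n≤n*2 k))
  ... | s , o , eq = suc s , o ,
    trans (cong (ℕ._* 2) eq) (trans (ℕₚ.*-comm (2 ^ s ℕ.* suc (o ℕ.* 2)) 2) (sym (ℕₚ.*-assoc 2 (2 ^ s) (suc (o ℕ.* 2)))))

even-automatic : ∀ m j → (∀ N → Coefficients.Even (suc N) N (suc j) (full m N)) → Automatic 2 (λ n → ν₂ (c m (suc n)))
even-automatic m j even-m =
  let s , o , eq = odd-part j
  -- A constant sequence is the image of `changes` under a constant map.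
  in  automatic changes changes-even changes-odd (λ _ → just (2 ℕ.+ s)) _
        (ν₂-even s o m λ N → subst (λ i → Coefficients.Even (suc N) N i (full m N)) eq (even-m N))

odd-automatic : ∀ m j → (∀ N → Coefficients.Odd (suc N) N (suc j) (full m N)) → Automatic 2 (λ n → ν₂ (c m (suc n)))
odd-automatic m j odd-m =
  let s , o , eq = odd-part j
  in  automatic changes changes-even changes-odd (λ b → if b then just 1 else just (2 ℕ.+ s)) _
        (ν₂-odd s o m λ N → subst (λ i → Coefficients.Odd (suc N) N i (full m N)) eq (odd-m N))

theorem2p7 : (m : ℤ) → m ≢ + 0 → m ≢ -[1+ 0 ] →
    Automatic 2 (λ n → ν₂ (c m (suc n)))
theorem2p7 (+ zero) m≢0 _ = contradiction refl m≢0
theorem2p7 (+ suc p) _ _ with parity p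
-- The parity is that of m - 1, so this is m = 2k + 1. `n<2^n N` provides K ≤ 2^N for K = N + 1.
... | even k = odd-automatic (+ suc (k ℕ.* 2)) k λ N → Coefficients.pos-odd (suc N) N k (n<2^n N)
... | odd k  = even-automatic (+ (suc k ℕ.* 2)) k λ N → Coefficients.pos-even (suc N) N (suc k) (n<2^n N)
theorem2p7 -[1+ q ] _ m≢-1 with parity q
-- Here m = -(q + 1), so even q means odd m. At q = 0 the exponent |m + 1| would be 0, which has no
-- odd part; this is the excluded m = -1.
... | even zero    = contradiction refl m≢-1
... | even (suc k) = odd-automatic -[1+ suc k ℕ.* 2 ] k λ N → Coefficients.neg-odd (suc N) N (suc k) (n<2^n N)
... | odd k        = even-automatic -[1+ suc (k ℕ.* 2) ] k λ N → Coefficients.neg-even (suc N) N k (n<2^n N)
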